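{- Let $d \ge 2$ be an integer. For integers $s \ge 1$ and $H \ge 1$, let $\mathcal H_d(s,H)$ be the set of polynomials $f(X) = a_dX^d + a_{d-1}X^{d-1} + \dots + a_1X + a_0 \in \mathbb{Z}[X]$ with $\max\{|a_0|,\ldots,|a_d|\} \le H$ such that (i) $s \mid a_i$ for $i=0,\ldots,d-1$, (ii) $\gcd(a_0/s, s) = 1$, and (iii) $\gcd(a_d, s) = 1$. Then for $s \le H$ we have $$ \#\mathcal H_d(s,H)=\frac{2^{d+1}H^{d+1}\varphi^2(s)}{s^{d+2}}+ O\left( \frac{H^{d}}{s^{d-1}} 2^{\omega(s)}\right), $$ where the implied constant may depend on $d$ only.
   Context: For an integer $n \ge 1$, $\omega(n)$ denotes the number of distinct prime factors of $n$ (with $\omega(1)=0$) and $\varphi(n)$ is Euler's totient function. The notation $U = O(V)$ means $|U| \le c|V|$ for some constant $c>0$. -}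

module Defs where

open import Data.Nat as ℕ using (ℕ; zero; suc; _*_; NonZero)
open import Data.Nat.DivMod using (_/_)
open import Data.Nat.GCD using (gcd)
open import Data.Nat.Divisibility using (_∣_; _∣?_)
open import Data.Nat.Primality using (Prime; prime?)
open import Data.Integer as ℤ using (ℤ; +_; ∣_∣)
open import Data.List using (List; []; _∷_; map; length; filter; upTo; concatMap)
open import Data.Vec as Vec using (Vec; head; last; init)
open import Data.Vec.Relation.Unary.All as All using (All)
open import Data.Product using (_×_)
open import Relation.Nullary.Decidable using (Dec; _×-dec_)
open import Relation.Binary.PropositionalEquality using (_≡_)

φ : ℕ → ℕ
φ n = length (filter (λ k → gcd k n ℕ.≟ 1) (map suc (upTo n)))

ω : ℕ → ℕ
ω n = length (filter (λ p → prime? p ×-dec (p ∣? n)) (upTo (suc n)))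

box : ℕ → List ℤ
box H = map (λ k → (+ k) ℤ.- (+ H)) (upTo (suc (2 * H)))

boxVecs : (m : ℕ) → ℕ → List (Vec ℤ m)
boxVecs zero H = Vec.[] ∷ []
boxVecs (suc m) H = concatMap (λ a → map (a Vec.∷_) (boxVecs m H)) (box H)

-- coefficient vector a = (a_0, a_1, ..., a_d) of f = a_d X^d + ... + a_0
-- (i) s ∣ a_i for i < d, (ii) gcd(a_0/s, s) = 1, (iii) gcd(a_d, s) = 1
InH : (d s : ℕ) .{{_ : NonZero s}} → Vec ℤ (suc d) → Set
InH d s a =
  All (λ c → s ∣ ∣ c ∣) (init a)
  × (gcd (∣ head a ∣ / s) s ≡ 1)
  × (gcd ∣ last a ∣ s ≡ 1)

InH? : (d s : ℕ) .{{_ : NonZero s}} → (a : Vec ℤ (suc d)) → Dec (InH d s a)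
InH? d s a =
  All.all? (λ c → s ∣? ∣ c ∣) (init a)
  ×-dec (gcd (∣ head a ∣ / s) s ℕ.≟ 1)
  ×-dec (gcd ∣ last a ∣ s ℕ.≟ 1)

countH : (d s H : ℕ) .{{_ : NonZero s}} → ℕ
countH d s H = length (filter (InH? d s) (boxVecs (suc d) H))

module Submission where

-- Choosing the coefficients independently, #H_d(s,H) = N₀ · N^(d-1) · N_d, where N counts the
-- multiples of s in [-H, H], N_d the integers there coprime to s, and N₀ the multiples s u with u
-- coprime to s. Each factor is 2H times its density (1/s, φ(s)/s, φ(s)/s²) up to a small error:
-- there are ⌊x/s⌋ multiples of s in [1, x], and by Legendre's inclusion-exclusion over the prime
-- divisors of s the number of j ≤ x coprime to s is x φ(s)/s + O(2^ω(s)). After rescaling each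
-- factor by a power of s to make it of size O(H) or O(H s), the error of the product telescopes
-- into d + 1 terms, each O(H^d s³ 2^ω(s)).

open import Algebra.Bundles using (CommutativeMonoid)
open import Data.Bool using (Bool; true; false; _∧_; not)
open import Data.Bool.Properties using (∧-assoc; ∧-identityʳ; ∧-commutativeMonoid)
open import Algebra.Properties.CommutativeSemigroup (CommutativeMonoid.commutativeSemigroup ∧-commutativeMonoid) renaming (interchange to ∧-interchange)
open import Data.Empty using (⊥-elim)
open import Data.Integer as ℤ using (ℤ; +_; ∣_∣)
import Data.Integer.Properties as ℤ
import Data.Integer.Tactic.RingSolver as ℤ-Solver
open import Data.List using (List; []; _∷_; map; length; filter; upTo; concatMap; _++_)
open import Data.List.Membership.Propositional using (_∈_)
open import Data.List.Membership.Propositional.Properties using (∈-filter⁺; ∈-filter⁻; ∈-upTo⁺)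
open import Data.List.Properties using (upTo-∷ʳ; map-applyUpTo)
open import Data.List.Relation.Unary.All as All using (All; []; _∷_)
open import Data.List.Relation.Unary.All.Properties using (all-filter)
open import Data.List.Relation.Unary.AllPairs using (AllPairs; []; _∷_)
open import Data.List.Relation.Unary.Any using (here; there)
import Data.List.Relation.Unary.Unique.Propositional.Properties as Unique
open import Data.Nat as ℕ using (ℕ; zero; suc; _+_; _*_; _^_; _≤_; _<_; _∸_; NonZero; ∣_-_∣; s≤s; z≤n)
open import Data.Nat.DivMod using (_/_; _%_; m≡m%n+[m/n]*n; m%n<n; m*n/n≡m; m/n*n≤m)
open import Data.Nat.Divisibility
open import Data.Nat.GCD using (gcd; gcd-greatest; gcd[m,n]∣m; gcd[m,n]∣n; gcd[m,n]≢0)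
open import Data.Nat.ListAction using (product)
open import Data.Nat.Primality using (Prime; prime?; euclidsLemma; prime⇒irreducible; prime⇒nonTrivial; productOfPrimes≢0; ¬prime[0])
open import Data.Nat.Primality.Factorisation using (factorise; PrimeFactorisation)
open import Data.Nat.Properties
open import Data.Nat.Tactic.RingSolver using (solve-∀)
open import Data.Product using (∃; _×_; _,_; proj₁)
open import Data.Sum using (inj₁; inj₂)
open import Data.Vec as Vec using (Vec)
import Data.Vec.Relation.Unary.All as VecAll
open import Function using (_∘_; id)
open import Relation.Binary.PropositionalEquality
open import Relation.Nullary using (¬_)
open import Relation.Nullary.Decidable using (Dec; does; yes; no; _×-dec_; dec-true; dec-false)
open import Relation.Unary using (Decidable)
open import Defs

private variable
  A B : Set

^-distrib-* : ∀ m n k → (m * n) ^ k ≡ m ^ k * n ^ k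
^-distrib-* m n zero    = refl
^-distrib-* m n (suc k) = trans (cong (m * n *_) (^-distrib-* m n k)) (interchange m n (m ^ k) (n ^ k))
  where
  interchange : ∀ a b c d → a * b * (c * d) ≡ a * c * (b * d)
  interchange = solve-∀

∣+m-+n∣≡∣m-n∣ : ∀ m n → ℤ.∣ + m ℤ.- + n ∣ ≡ ∣ m - n ∣
∣+m-+n∣≡∣m-n∣ m n = trans (cong ℤ.∣_∣ (ℤ.m-n≡m⊖n m n)) (∣m⊖n∣≡∣m-n∣ m n)
  where
  ∣m⊖n∣≡∣m-n∣ : ∀ m n → ℤ.∣ m ℤ.⊖ n ∣ ≡ ∣ m - n ∣
  ∣m⊖n∣≡∣m-n∣ zero    zero    = refl
  ∣m⊖n∣≡∣m-n∣ zero    (suc n) = refl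
  ∣m⊖n∣≡∣m-n∣ (suc m) zero    = refl
  ∣m⊖n∣≡∣m-n∣ (suc m) (suc n) = trans (cong ℤ.∣_∣ (ℤ.[1+m]⊖[1+n]≡m⊖n m n)) (∣m⊖n∣≡∣m-n∣ m n)

∣m-n+o∣≤∣m-n∣+o : ∀ m n o → ∣ m - (n + o) ∣ ≤ ∣ m - n ∣ + o
∣m-n+o∣≤∣m-n∣+o m n o = ≤-trans (∣-∣-triangle m n (n + o)) (+-monoʳ-≤ ∣ m - n ∣ (≤-reflexive (∣m-m+n∣≡n n o)))

∣m+o-n∣≤∣m-n∣+o : ∀ m n o → ∣ m + o - n ∣ ≤ ∣ m - n ∣ + o
∣m+o-n∣≤∣m-n∣+o m n o = begin
  ∣ m + o - n ∣     ≡⟨ ∣-∣-comm (m + o) n ⟩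
  ∣ n - (m + o) ∣   ≤⟨ ∣m-n+o∣≤∣m-n∣+o n m o ⟩
  ∣ n - m ∣ + o     ≡⟨ cong (_+ o) (∣-∣-comm n m) ⟩
  ∣ m - n ∣ + o     ∎
  where open ≤-Reasoning

∣m*n-o*p∣≤ : ∀ {m n o p α β M O} → ∣ m - o ∣ ≤ α → ∣ n - p ∣ ≤ β → n ≤ M → o ≤ O →
  ∣ m * n - o * p ∣ ≤ α * M + O * β
∣m*n-o*p∣≤ {m} {n} {o} {p} {α} {β} {M} {O} m≈o n≈p n≤M o≤O = begin
  ∣ m * n - o * p ∣                  ≤⟨ ∣-∣-triangle (m * n) (o * n) (o * p) ⟩
  ∣ m * n - o * n ∣ + ∣ o * n - o * p ∣ ≡⟨ cong₂ _+_ (*-distribʳ-∣-∣ n m o) (*-distribˡ-∣-∣ o n p) ⟨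
  ∣ m - o ∣ * n + o * ∣ n - p ∣       ≤⟨ +-mono-≤ (*-mono-≤ m≈o n≤M) (*-mono-≤ o≤O n≈p) ⟩
  α * M + O * β                      ∎
  where open ≤-Reasoning

∣m^n-o^n∣≤ : ∀ {m o M} → m ≤ M → o ≤ M → ∀ n → ∣ m ^ suc n - o ^ suc n ∣ ≤ suc n * ∣ m - o ∣ * M ^ n
∣m^n-o^n∣≤ {m} {o} {M} m≤M o≤M zero =
  ≤-reflexive (trans (cong₂ ∣_-_∣ (*-identityʳ m) (*-identityʳ o)) (sym (trans (*-identityʳ _) (+-identityʳ _))))
∣m^n-o^n∣≤ {m} {o} {M} m≤M o≤M (suc n) = begin
    ∣ m * m ^ suc n - o * o ^ suc n ∣
  ≤⟨ ∣m*n-o*p∣≤ {m} {o = o} ≤-refl (∣m^n-o^n∣≤ m≤M o≤M n) (^-monoˡ-≤ (suc n) m≤M) o≤M ⟩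
    ∣ m - o ∣ * M ^ suc n + M * (suc n * ∣ m - o ∣ * M ^ n)
  ≡⟨ telescope ∣ m - o ∣ M (M ^ n) n ⟩
    suc (suc n) * ∣ m - o ∣ * M ^ suc n ∎
  where
  open ≤-Reasoning
  telescope : ∀ δ M X n → δ * (M * X) + M * (suc n * δ * X) ≡ suc (suc n) * δ * (M * X)
  telescope = solve-∀

∣a*b^n*c-t*u^n*v∣≤ : ∀ {a b c t u v α β γ A B C} n →
  ∣ a - t ∣ ≤ α → ∣ b - u ∣ ≤ β → ∣ c - v ∣ ≤ γ → t ≤ A → b ≤ B → u ≤ B → c ≤ C →
  ∣ a * (b ^ suc n * c) - t * (u ^ suc n * v) ∣ ≤ α * (B ^ suc n * C) + A * (suc n * β * B ^ n * C + B ^ suc n * γ)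
∣a*b^n*c-t*u^n*v∣≤ {a} {b} {c} {t} {u} {v} {β = β} {B = B} n a≈t b≈u c≈v t≤A b≤B u≤B c≤C =
  ∣m*n-o*p∣≤ {a} {b ^ suc n * c} {t} {u ^ suc n * v} a≈t
    (∣m*n-o*p∣≤ {b ^ suc n} {c} {u ^ suc n} {v}
      (≤-trans (∣m^n-o^n∣≤ b≤B u≤B n) (*-monoˡ-≤ (B ^ n) (*-monoʳ-≤ (suc n) b≈u))) c≈v c≤C (^-monoˡ-≤ (suc n) u≤B))
    (*-mono-≤ (^-monoˡ-≤ (suc n) b≤B) c≤C) t≤A

𝟙 : Bool → ℕ
𝟙 true  = 1
𝟙 false = 0

𝟙≤1 : ∀ b → 𝟙 b ≤ 1
𝟙≤1 true  = ≤-refl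
𝟙≤1 false = z≤n

does-⇔ : (a? : Dec A) (b? : Dec B) → (A → B) → (B → A) → does a? ≡ does b?
does-⇔ (yes a)  b? f g = sym (dec-true b? (f a))
does-⇔ (no ¬a) b? f g = sym (dec-false b? (¬a ∘ g))

count : (A → Bool) → List A → ℕ
count f []       = 0
count f (x ∷ xs) = 𝟙 (f x) + count f xs

length-filter : {P : A → Set} (P? : Decidable P) (xs : List A) →
  length (filter P? xs) ≡ count (does ∘ P?) xs
length-filter P? [] = refl
length-filter P? (x ∷ xs) with does (P? x)
... | true  = cong suc (length-filter P? xs)
... | false = length-filter P? xs

count-++ : (f : A → Bool) (xs ys : List A) → count f (xs ++ ys) ≡ count f xs + count f ys
count-++ f []       ys = refl
count-++ f (x ∷ xs) ys = trans (cong (_+_ (𝟙 (f x))) (count-++ f xs ys)) (sym (+-assoc (𝟙 (f x)) _ _))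

count-map : (f : B → Bool) (g : A → B) (xs : List A) → count f (map g xs) ≡ count (f ∘ g) xs
count-map f g []       = refl
count-map f g (x ∷ xs) = cong (_+_ (𝟙 (f (g x)))) (count-map f g xs)

count-cong : {f g : A → Bool} → (∀ x → f x ≡ g x) → (xs : List A) → count f xs ≡ count g xs
count-cong e []       = refl
count-cong e (x ∷ xs) = cong₂ _+_ (cong 𝟙 (e x)) (count-cong e xs)

count-∧ˡ : (b : Bool) (f : A → Bool) (xs : List A) → count (λ x → b ∧ f x) xs ≡ 𝟙 b * count f xs
count-∧ˡ true  f xs = sym (+-identityʳ _)
count-∧ˡ false f []       = refl
count-∧ˡ false f (x ∷ xs) = count-∧ˡ false f xs

count-concatMap-∷ : ∀ {n} (f : Vec A (suc n) → Bool) (u : A → Bool) (v : Vec A n → Bool) →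
  (∀ a r → f (a Vec.∷ r) ≡ u a ∧ v r) → (as : List A) (rs : List (Vec A n)) →
  count f (concatMap (λ a → map (a Vec.∷_) rs) as) ≡ count u as * count v rs
count-concatMap-∷ f u v split [] rs = refl
count-concatMap-∷ f u v split (a ∷ as) rs = begin
    count f (map (a Vec.∷_) rs ++ rest)
  ≡⟨ count-++ f (map (a Vec.∷_) rs) rest ⟩
    count f (map (a Vec.∷_) rs) + count f rest
  ≡⟨ cong₂ _+_ (trans (count-map f _ rs) (trans (count-cong (split a) rs) (count-∧ˡ (u a) v rs)))
               (count-concatMap-∷ f u v split as rs) ⟩
    𝟙 (u a) * count v rs + count u as * count v rs
  ≡⟨ sym (*-distribʳ-+ (count v rs) (𝟙 (u a)) (count u as)) ⟩
    (𝟙 (u a) + count u as) * count v rs ∎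
  where
  open ≡-Reasoning
  rest = concatMap (λ a → map (a Vec.∷_) rs) as

countTo : (ℕ → Bool) → ℕ → ℕ
countTo g zero    = 0
countTo g (suc n) = countTo g n + 𝟙 (g (suc n))

countTo-cong : {f g : ℕ → Bool} → (∀ x → f x ≡ g x) → ∀ n → countTo f n ≡ countTo g n
countTo-cong e zero    = refl
countTo-cong e (suc n) = cong₂ _+_ (countTo-cong e n) (cong 𝟙 (e (suc n)))

countTo-true : ∀ n → countTo (λ _ → true) n ≡ n
countTo-true zero    = refl
countTo-true (suc n) = trans (cong (_+ 1) (countTo-true n)) (+-comm n 1)

countTo≤ : ∀ g n → countTo g n ≤ n
countTo≤ g zero    = z≤n
countTo≤ g (suc n) = subst (countTo g n + 𝟙 (g (suc n)) ≤_) (+-comm n 1) (+-mono-≤ (countTo≤ g n) (𝟙≤1 (g (suc n))))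

countTo-+ : ∀ g m n → countTo g (m + n) ≡ countTo g m + countTo (λ j → g (m + j)) n
countTo-+ g m zero    = trans (cong (countTo g) (+-identityʳ m)) (sym (+-identityʳ _))
countTo-+ g m (suc n) = begin
    countTo g (m + suc n)
  ≡⟨ cong (countTo g) (+-suc m n) ⟩
    countTo g (m + n) + 𝟙 (g (suc (m + n)))
  ≡⟨ cong₂ _+_ (countTo-+ g m n) (cong (𝟙 ∘ g) (sym (+-suc m n))) ⟩
    countTo g m + countTo (λ j → g (m + j)) n + 𝟙 (g (m + suc n))
  ≡⟨ +-assoc (countTo g m) _ _ ⟩
    countTo g m + countTo (λ j → g (m + j)) (suc n) ∎
  where open ≡-Reasoning

countTo-not+countTo : ∀ (u v : ℕ → Bool) n →
  countTo (λ j → not (u j) ∧ v j) n + countTo (λ j → u j ∧ v j) n ≡ countTo v n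
countTo-not+countTo u v zero    = refl
countTo-not+countTo u v (suc n) =
  trans (interchange (countTo (λ j → not (u j) ∧ v j) n) _ (countTo (λ j → u j ∧ v j) n) _)
        (cong₂ _+_ (countTo-not+countTo u v n) (𝟙-not∧+𝟙-∧ (u (suc n)) (v (suc n))))
  where
  interchange : ∀ a b c d → (a + b) + (c + d) ≡ (a + c) + (b + d)
  interchange = solve-∀
  𝟙-not∧+𝟙-∧ : ∀ x y → 𝟙 (not x ∧ y) + 𝟙 (x ∧ y) ≡ 𝟙 y
  𝟙-not∧+𝟙-∧ true  y = refl
  𝟙-not∧+𝟙-∧ false y = +-identityʳ _

count-upTo : (g : ℕ → Bool) (n : ℕ) → count (g ∘ suc) (upTo n) ≡ countTo g n
count-upTo g zero    = refl
count-upTo g (suc n) = begin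
    count (g ∘ suc) (upTo (suc n))
  ≡⟨ cong (count (g ∘ suc)) (sym (upTo-∷ʳ n)) ⟩
    count (g ∘ suc) (upTo n ++ n ∷ [])
  ≡⟨ count-++ (g ∘ suc) (upTo n) (n ∷ []) ⟩
    count (g ∘ suc) (upTo n) + (𝟙 (g (suc n)) + 0)
  ≡⟨ cong₂ _+_ (count-upTo g n) (+-identityʳ _) ⟩
    countTo g (suc n) ∎
  where open ≡-Reasoning

boxCount : (ℕ → Bool) → ℕ → ℕ
boxCount g H = count (g ∘ ℤ.∣_∣) (box H)

-- Going from H to H + 1 adds the two end points k = 0 and k = 2H + 2, i.e. the values ±(H + 1).
boxCount-shifted : ∀ g H → count (λ k → g ∣ k - H ∣) (upTo (suc (2 * H))) ≡ 𝟙 (g 0) + 2 * countTo g H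
boxCount-shifted g zero    = refl
boxCount-shifted g (suc H) = begin
    count gH+1 (upTo (suc (2 * suc H)))
  ≡⟨ cong (λ z → count gH+1 (upTo (suc z))) (*-suc 2 H) ⟩
    count gH+1 (upTo (suc (suc (suc (2 * H)))))
  ≡⟨ cong (λ xs → 𝟙 (g (suc H)) + count gH+1 xs) (sym (map-applyUpTo id suc (suc (suc (2 * H))))) ⟩
    𝟙 (g (suc H)) + count gH+1 (map suc (upTo (suc (suc (2 * H)))))
  ≡⟨ cong (_+_ (𝟙 (g (suc H)))) (count-map gH+1 suc (upTo (suc (suc (2 * H))))) ⟩
    𝟙 (g (suc H)) + count gH (upTo (suc (suc (2 * H))))
  ≡⟨ cong (λ xs → 𝟙 (g (suc H)) + count gH xs) (sym (upTo-∷ʳ (suc (2 * H)))) ⟩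
    𝟙 (g (suc H)) + count gH (upTo (suc (2 * H)) ++ suc (2 * H) ∷ [])
  ≡⟨ cong (_+_ (𝟙 (g (suc H)))) (count-++ gH (upTo (suc (2 * H))) _) ⟩
    𝟙 (g (suc H)) + (count gH (upTo (suc (2 * H))) + (𝟙 (g ∣ suc (2 * H) - H ∣) + 0))
  ≡⟨ cong₂ (λ a b → 𝟙 (g (suc H)) + (a + (𝟙 (g b) + 0))) (boxCount-shifted g H) ∣2H+1-H∣≡H+1 ⟩
    𝟙 (g (suc H)) + (𝟙 (g 0) + 2 * countTo g H + (𝟙 (g (suc H)) + 0))
  ≡⟨ rearrange (𝟙 (g (suc H))) (𝟙 (g 0)) (countTo g H) ⟩
    𝟙 (g 0) + 2 * countTo g (suc H) ∎
  where
  open ≡-Reasoning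
  gH gH+1 : ℕ → Bool
  gH k = g ∣ k - H ∣
  gH+1 k = g ∣ k - suc H ∣
  ∣2H+1-H∣≡H+1 : ∣ suc (2 * H) - H ∣ ≡ suc H
  ∣2H+1-H∣≡H+1 = trans (cong (∣_- H ∣) (trans (cong suc (cong (_+_ H) (+-identityʳ H))) (sym (+-suc H H))))
                       (trans (∣-∣-comm (H + suc H) H) (∣m-m+n∣≡n H (suc H)))
  rearrange : ∀ a b c → a + (b + 2 * c + (a + 0)) ≡ b + 2 * (c + a)
  rearrange = solve-∀

boxCount≡ : ∀ g H → boxCount g H ≡ 𝟙 (g 0) + 2 * countTo g H
boxCount≡ g H = begin
    count (g ∘ ℤ.∣_∣) (map (λ k → + k ℤ.- + H) (upTo (suc (2 * H))))
  ≡⟨ count-map (g ∘ ℤ.∣_∣) _ (upTo (suc (2 * H))) ⟩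
    count (λ k → g ℤ.∣ + k ℤ.- + H ∣) (upTo (suc (2 * H)))
  ≡⟨ count-cong (λ k → cong g (∣+m-+n∣≡∣m-n∣ k H)) (upTo (suc (2 * H))) ⟩
    count (λ k → g ∣ k - H ∣) (upTo (suc (2 * H)))
  ≡⟨ boxCount-shifted g H ⟩
    𝟙 (g 0) + 2 * countTo g H ∎
  where open ≡-Reasoning

module _ (p : ℕ) .{{_ : NonZero p}} (h′ h : ℕ → Bool) (h′-scale : ∀ c → h′ (c * p) ≡ h c) where

  private
    g : ℕ → Bool
    g j = does (p ∣? j) ∧ h′ j

    countTo-below-multiple : ∀ q r → r < p → countTo g (q * p + r) ≡ countTo g (q * p)
    countTo-below-multiple q zero    _   = cong (countTo g) (+-identityʳ (q * p))
    countTo-below-multiple q (suc r) r<p = begin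
        countTo g (q * p + suc r)
      ≡⟨ cong (countTo g) (+-suc (q * p) r) ⟩
        countTo g (q * p + r) + 𝟙 (g (suc (q * p + r)))
      ≡⟨ cong₂ _+_ (countTo-below-multiple q r (<-trans (n<1+n r) r<p))
                   (cong (λ b → 𝟙 (b ∧ h′ (suc (q * p + r)))) (dec-false (p ∣? suc (q * p + r)) p∤)) ⟩
        countTo g (q * p) + 0
      ≡⟨ +-identityʳ _ ⟩
        countTo g (q * p) ∎
      where
      open ≡-Reasoning
      p∤ : ¬ (p ∣ suc (q * p + r))
      p∤ p∣ = <⇒≱ r<p (∣⇒≤ (∣m+n∣m⇒∣n (subst (p ∣_) (sym (+-suc (q * p) r)) p∣) (n∣m*n q)))

    countTo-multiple : ∀ q → countTo g (q * p) ≡ countTo h q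
    countTo-multiple zero    = refl
    countTo-multiple (suc q) = begin
        countTo g (suc q * p)
      ≡⟨ cong (countTo g) last-step ⟩
        countTo g (q * p + ℕ.pred p) + 𝟙 (g (suc (q * p + ℕ.pred p)))
      ≡⟨ cong₂ _+_ (countTo-below-multiple q (ℕ.pred p) (subst (ℕ.pred p <_) (suc-pred p) ≤-refl))
                   (cong (𝟙 ∘ g) (sym last-step)) ⟩
        countTo g (q * p) + 𝟙 (does (p ∣? suc q * p) ∧ h′ (suc q * p))
      ≡⟨ cong₂ (λ b c → countTo g (q * p) + 𝟙 (b ∧ c)) (dec-true (p ∣? suc q * p) (n∣m*n (suc q))) (h′-scale (suc q)) ⟩
        countTo g (q * p) + 𝟙 (h (suc q))
      ≡⟨ cong (_+ 𝟙 (h (suc q))) (countTo-multiple q) ⟩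
        countTo h (suc q) ∎
      where
      open ≡-Reasoning
      last-step : suc q * p ≡ suc (q * p + ℕ.pred p)
      last-step = trans (+-comm p (q * p)) (trans (cong (_+_ (q * p)) (sym (suc-pred p))) (+-suc (q * p) (ℕ.pred p)))

  countTo-multiples : ∀ x → countTo (λ j → does (p ∣? j) ∧ h′ j) x ≡ countTo h (x / p)
  countTo-multiples x = begin
      countTo g x
    ≡⟨ cong (countTo g) (trans (m≡m%n+[m/n]*n x p) (+-comm (x % p) _)) ⟩
      countTo g (x / p * p + x % p)
    ≡⟨ countTo-below-multiple (x / p) (x % p) (m%n<n x p) ⟩
      countTo g (x / p * p)
    ≡⟨ countTo-multiple (x / p) ⟩
      countTo h (x / p) ∎
    where open ≡-Reasoning

noneDivides : List ℕ → ℕ → Bool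
noneDivides []       j = true
noneDivides (p ∷ ps) j = not (does (p ∣? j)) ∧ noneDivides ps j

sifted : List ℕ → ℕ → ℕ
sifted ps = countTo (noneDivides ps)

-- productPred ps / product ps = ∏ (1 - 1/p) is the density of the integers sifted by ps.
productPred : List ℕ → ℕ
productPred []       = 1
productPred (p ∷ ps) = (p ∸ 1) * productPred ps

DistinctPrimes : List ℕ → Set
DistinctPrimes ps = All Prime ps × AllPairs _≢_ ps

productPred≤product : ∀ ps → productPred ps ≤ product ps
productPred≤product []       = ≤-refl
productPred≤product (p ∷ ps) = *-mono-≤ (m∸n≤m p 1) (productPred≤product ps)

noneDivides-* : ∀ {p} → Prime p → ∀ {ps} → All Prime ps → All (p ≢_) ps →
  ∀ c → noneDivides ps (c * p) ≡ noneDivides ps c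
noneDivides-* pp []          []          c = refl
noneDivides-* {p} pp {q ∷ ps} (pq ∷ pps) (p≢q ∷ p≢ps) c =
  cong₂ _∧_ (cong not (does-⇔ (q ∣? c * p) (q ∣? c) q∣c*p⇒q∣c (∣m⇒∣m*n p))) (noneDivides-* pp pps p≢ps c)
  where
  q∣c*p⇒q∣c : q ∣ c * p → q ∣ c
  q∣c*p⇒q∣c q∣c*p with euclidsLemma c p pq q∣c*p
  ... | inj₁ q∣c = q∣c
  ... | inj₂ q∣p with prime⇒irreducible pp q∣p
  ...   | inj₁ q≡1 = ⊥-elim (ℕ.nonTrivial⇒≢1 {{prime⇒nonTrivial pq}} q≡1)
  ...   | inj₂ q≡p = ⊥-elim (p≢q (sym q≡p))

sifted-∷ : ∀ p .{{_ : NonZero p}} ps → DistinctPrimes (p ∷ ps) → ∀ x → sifted (p ∷ ps) x + sifted ps (x / p) ≡ sifted ps x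
sifted-∷ p ps (pp ∷ pps , p≢ps ∷ _) x = begin
    sifted (p ∷ ps) x + sifted ps (x / p)
  ≡⟨ cong (_+_ (sifted (p ∷ ps) x)) (sym (countTo-multiples p (noneDivides ps) (noneDivides ps) (noneDivides-* pp pps p≢ps) x)) ⟩
    sifted (p ∷ ps) x + countTo (λ j → does (p ∣? j) ∧ noneDivides ps j) x
  ≡⟨ countTo-not+countTo (λ j → does (p ∣? j)) (noneDivides ps) x ⟩
    sifted ps x ∎
  where open ≡-Reasoning

sifted-product-multiple : ∀ ps → DistinctPrimes ps → ∀ t → sifted ps (product ps * t) ≡ t * productPred ps
sifted-product-multiple []             _ t = trans (countTo-true (1 * t)) (*-comm 1 t)
sifted-product-multiple (zero ∷ ps)    (p0 ∷ _ , _) t = ⊥-elim (¬prime[0] p0)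
sifted-product-multiple (suc p′ ∷ ps) distinct@(_ ∷ pps , _ ∷ ps-distinct) t =
  +-cancelʳ-≡ (t * F) _ _ (begin
    sifted (p ∷ ps) x + t * F
  ≡⟨ cong (_+_ (sifted (p ∷ ps) x)) (sym (trans (cong (sifted ps) x/p≡P*t) (IH t))) ⟩
    sifted (p ∷ ps) x + sifted ps (x / p)
  ≡⟨ sifted-∷ p ps distinct x ⟩
    sifted ps x
  ≡⟨ cong (sifted ps) (x≡P*[p*t] p P t) ⟩
    sifted ps (P * (p * t))
  ≡⟨ IH (p * t) ⟩
    p * t * F
  ≡⟨ p*t*F≡t*[p′*F]+t*F p′ t F ⟩
    t * (p′ * F) + t * F ∎)
  where
  open ≡-Reasoning
  p = suc p′
  P = product ps
  F = productPred ps
  x = p * P * t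
  IH : ∀ t → sifted ps (P * t) ≡ t * F
  IH = sifted-product-multiple ps (pps , ps-distinct)
  x≡P*[p*t] : ∀ p P t → p * P * t ≡ P * (p * t)
  x≡P*[p*t] = solve-∀
  p*t*F≡t*[p′*F]+t*F : ∀ p′ t F → suc p′ * t * F ≡ t * (p′ * F) + t * F
  p*t*F≡t*[p′*F]+t*F = solve-∀
  x/p≡P*t : x / p ≡ P * t
  x/p≡P*t = trans (cong (_/ p) (trans (*-assoc p P t) (*-comm p (P * t)))) (m*n/n≡m (P * t) p)

private
  siftError : List ℕ → ℕ → ℤ
  siftError ps x = + sifted ps x ℤ.* + product ps ℤ.- + x ℤ.* + productPred ps

  ∣siftError∣ : ∀ ps x → ℤ.∣ siftError ps x ∣ ≡ ∣ sifted ps x * product ps - x * productPred ps ∣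
  ∣siftError∣ ps x = trans
    (cong ℤ.∣_∣ (cong₂ ℤ._-_ (sym (ℤ.pos-* (sifted ps x) (product ps))) (sym (ℤ.pos-* x (productPred ps)))))
    (∣+m-+n∣≡∣m-n∣ (sifted ps x * product ps) (x * productPred ps))

  -- Legendre's identity sifted (p ∷ ps) x = sifted ps x - sifted ps ⌊x/p⌋, with x = ⌊x/p⌋ p + r.
  siftError-∷ : ∀ p′ ps → DistinctPrimes (suc p′ ∷ ps) → ∀ x →
    siftError (suc p′ ∷ ps) x ≡
      + suc p′ ℤ.* (siftError ps x ℤ.- siftError ps (x / suc p′)) ℤ.+ + (x % suc p′) ℤ.* + productPred ps
  siftError-∷ p′ ps distinct x = begin
      + n′ ℤ.* + (p * P) ℤ.- + x ℤ.* + (p′ * F)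
    ≡⟨ cong₃ (λ u v w → + n′ ℤ.* u ℤ.- v ℤ.* w) (ℤ.pos-* p P) +x≡+y*+p++r (ℤ.pos-* p′ F) ⟩
      + n′ ℤ.* (+ p ℤ.* + P) ℤ.- (+ y ℤ.* + p ℤ.+ + r) ℤ.* (+ p′ ℤ.* + F)
    ≡⟨ legendre (+ n′) (+ b) (+ y) (+ r) (+ p′) (+ P) (+ F) ⟩
      + p ℤ.* ((+ n′ ℤ.+ + b) ℤ.* + P ℤ.- (+ y ℤ.* + p ℤ.+ + r) ℤ.* + F ℤ.- siftError ps y) ℤ.+ + r ℤ.* + F
    ≡⟨ cong₂ (λ u v → + p ℤ.* (+ u ℤ.* + P ℤ.- v ℤ.* + F ℤ.- siftError ps y) ℤ.+ + r ℤ.* + F)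
             (sifted-∷ p ps distinct x) (sym +x≡+y*+p++r) ⟩
      + p ℤ.* (siftError ps x ℤ.- siftError ps y) ℤ.+ + r ℤ.* + F ∎
    where
    open ≡-Reasoning
    p = suc p′
    P = product ps
    F = productPred ps
    y = x / p
    r = x % p
    n′ = sifted (p ∷ ps) x
    b = sifted ps y
    cong₃ : ∀ {A B C D : Set} (f : A → B → C → D) {a a′ b b′ c c′} →
      a ≡ a′ → b ≡ b′ → c ≡ c′ → f a b c ≡ f a′ b′ c′
    cong₃ f refl refl refl = refl
    +x≡+y*+p++r : + x ≡ + y ℤ.* + p ℤ.+ + r
    +x≡+y*+p++r = trans (cong +_ (trans (m≡m%n+[m/n]*n x p) (+-comm r (y * p)))) (cong (ℤ._+ + r) (ℤ.pos-* y p))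
    legendre : ∀ n′ b y r p′ P F →
      n′ ℤ.* ((ℤ.1ℤ ℤ.+ p′) ℤ.* P) ℤ.- (y ℤ.* (ℤ.1ℤ ℤ.+ p′) ℤ.+ r) ℤ.* (p′ ℤ.* F)
      ≡ (ℤ.1ℤ ℤ.+ p′) ℤ.* ((n′ ℤ.+ b) ℤ.* P ℤ.- (y ℤ.* (ℤ.1ℤ ℤ.+ p′) ℤ.+ r) ℤ.* F ℤ.- (b ℤ.* P ℤ.- y ℤ.* F))
        ℤ.+ r ℤ.* F
    legendre = ℤ-Solver.solve-∀

  ∣p*[a-b]+c∣≤ : ∀ p a b c → ℤ.∣ + p ℤ.* (a ℤ.- b) ℤ.+ c ∣ ≤ p * (ℤ.∣ a ∣ + ℤ.∣ b ∣) + ℤ.∣ c ∣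
  ∣p*[a-b]+c∣≤ p a b c = ≤-trans (ℤ.∣i+j∣≤∣i∣+∣j∣ (+ p ℤ.* (a ℤ.- b)) c)
    (+-monoˡ-≤ ℤ.∣ c ∣ (≤-trans (≤-reflexive (ℤ.abs-* (+ p) (a ℤ.- b))) (*-monoʳ-≤ p (ℤ.∣i-j∣≤∣i∣+∣j∣ a b))))

  ∣siftError∣+product≤ : ∀ ps → DistinctPrimes ps → ∀ x →
    ℤ.∣ siftError ps x ∣ + product ps ≤ product ps * 2 ^ suc (length ps)
  ∣siftError∣+product≤ [] _ x = ≤-trans (≤-reflexive (cong (λ z → z + 1) (trans (∣siftError∣ [] x) ∣N-x∣≡0))) (s≤s z≤n)
    where
    ∣N-x∣≡0 : ∣ sifted [] x * 1 - x * 1 ∣ ≡ 0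
    ∣N-x∣≡0 = trans (cong (λ z → ∣ z * 1 - x * 1 ∣) (countTo-true x)) (∣n-n∣≡0 (x * 1))
  ∣siftError∣+product≤ (zero ∷ ps) (p0 ∷ _ , _) x = ⊥-elim (¬prime[0] p0)
  ∣siftError∣+product≤ (suc p′ ∷ ps) distinct@(_ ∷ pps , _ ∷ ps-distinct) x = begin
      ℤ.∣ siftError (p ∷ ps) x ∣ + p * P
    ≡⟨ cong (λ z → ℤ.∣ z ∣ + p * P) (siftError-∷ p′ ps distinct x) ⟩
      ℤ.∣ + p ℤ.* (siftError ps x ℤ.- siftError ps y) ℤ.+ + r ℤ.* + F ∣ + p * P
    ≤⟨ +-monoˡ-≤ (p * P) (∣p*[a-b]+c∣≤ p (siftError ps x) (siftError ps y) (+ r ℤ.* + F)) ⟩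
      p * (ex + ey) + ℤ.∣ + r ℤ.* + F ∣ + p * P
    ≤⟨ +-monoˡ-≤ (p * P) (+-monoʳ-≤ (p * (ex + ey)) (≤-trans (≤-reflexive (ℤ.abs-* (+ r) (+ F)))
                                                              (*-mono-≤ (<⇒≤ (m%n<n x p)) (productPred≤product ps)))) ⟩
      p * (ex + ey) + p * P + p * P
    ≡⟨ regroup p ex ey P ⟩
      p * ((ex + P) + (ey + P))
    ≤⟨ *-monoʳ-≤ p (+-mono-≤ (IH x) (IH y)) ⟩
      p * (P * k + P * k)
    ≡⟨ double p P k ⟩
      p * P * (2 * k) ∎
    where
    open ≤-Reasoning
    p = suc p′
    P = product ps
    F = productPred ps
    y = x / p
    r = x % p
    k = 2 ^ suc (length ps)
    ex = ℤ.∣ siftError ps x ∣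
    ey = ℤ.∣ siftError ps y ∣
    IH : ∀ x → ℤ.∣ siftError ps x ∣ + P ≤ P * k
    IH = ∣siftError∣+product≤ ps (pps , ps-distinct)
    regroup : ∀ p a b P → p * (a + b) + p * P + p * P ≡ p * ((a + P) + (b + P))
    regroup = solve-∀
    double : ∀ p P k → p * (P * k + P * k) ≡ p * P * (2 * k)
    double = solve-∀

siftedError+product≤ : ∀ ps → DistinctPrimes ps → ∀ x →
  ∣ sifted ps x * product ps - x * productPred ps ∣ + product ps ≤ product ps * 2 ^ suc (length ps)
siftedError+product≤ ps distinct x = subst (λ e → e + product ps ≤ _) (∣siftError∣ ps x) (∣siftError∣+product≤ ps distinct x)

noneDivides-true : ∀ ps j → (∀ p → p ∈ ps → ¬ p ∣ j) → noneDivides ps j ≡ true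
noneDivides-true []       j _    = refl
noneDivides-true (p ∷ ps) j p∤j =
  cong₂ _∧_ (cong not (dec-false (p ∣? j) (p∤j p (here refl)))) (noneDivides-true ps j (λ q q∈ → p∤j q (there q∈)))

noneDivides-false : ∀ ps j p → p ∈ ps → p ∣ j → noneDivides ps j ≡ false
noneDivides-false (q ∷ ps) j .q (here refl) q∣j = cong (λ b → not b ∧ noneDivides ps j) (dec-true (q ∣? j) q∣j)
noneDivides-false (q ∷ ps) j p  (there p∈)  p∣j with does (q ∣? j)
... | true  = refl
... | false = noneDivides-false ps j p p∈ p∣j

coprimeTo : ℕ → ℕ → Bool
coprimeTo s j = does (gcd j s ℕ.≟ 1)

gcd[k*s+j,s]≡gcd[j,s] : ∀ k s j → gcd (k * s + j) s ≡ gcd j s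
gcd[k*s+j,s]≡gcd[j,s] k s j = ∣-antisym
  (gcd-greatest (∣m+n∣m⇒∣n (gcd[m,n]∣m (k * s + j) s) (∣n⇒∣m*n k (gcd[m,n]∣n (k * s + j) s))) (gcd[m,n]∣n (k * s + j) s))
  (gcd-greatest (∣m∣n⇒∣m+n (∣n⇒∣m*n k (gcd[m,n]∣n j s)) (gcd[m,n]∣m j s)) (gcd[m,n]∣n j s))

module _ (s : ℕ) .{{_ : NonZero s}} where

  primeDivisors : List ℕ
  primeDivisors = filter (λ p → prime? p ×-dec p ∣? s) (upTo (suc s))

  primeDivisors-distinct : DistinctPrimes primeDivisors
  primeDivisors-distinct =
    All.map proj₁ (all-filter (λ p → prime? p ×-dec p ∣? s) (upTo (suc s))) ,
    Unique.filter⁺ (λ p → prime? p ×-dec p ∣? s) (Unique.upTo⁺ (suc s))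

  coprimeTo≡noneDivides : ∀ j → coprimeTo s j ≡ noneDivides primeDivisors j
  coprimeTo≡noneDivides j = by-cases (gcd j s ℕ.≟ 1)
    where
    g = gcd j s
    by-cases : (g≟1 : Dec (g ≡ 1)) → does g≟1 ≡ noneDivides primeDivisors j
    by-cases (yes g≡1) = sym (noneDivides-true primeDivisors j λ p p∈ p∣j →
      let (_ , pp , p∣s) = ∈-filter⁻ (λ p → prime? p ×-dec p ∣? s) {xs = upTo (suc s)} p∈
      in ℕ.nonTrivial⇒≢1 {{prime⇒nonTrivial pp}} (∣1⇒≡1 (subst (p ∣_) g≡1 (gcd-greatest p∣j p∣s))))
    by-cases (no g≢1) = sym (shared-prime (factorise g {{g≢0}}))
      where
      g≢0 : NonZero g
      g≢0 = ℕ.≢-nonZero (gcd[m,n]≢0 j s (inj₂ (ℕ.≢-nonZero⁻¹ s)))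
      shared-prime : PrimeFactorisation g → noneDivides primeDivisors j ≡ false
      shared-prime record { factors = [] ; isFactorisation = g≡1 } = ⊥-elim (g≢1 g≡1)
      shared-prime record { factors = q ∷ qs ; isFactorisation = g≡q*qs ; factorsPrime = pq ∷ _ } =
        noneDivides-false primeDivisors j q
          (∈-filter⁺ (λ p → prime? p ×-dec p ∣? s) (∈-upTo⁺ (s≤s (∣⇒≤ q∣s))) (pq , q∣s))
          (∣-trans q∣g (gcd[m,n]∣m j s))
        where
        q∣g : q ∣ g
        q∣g = subst (q ∣_) (sym g≡q*qs) (m∣m*n (product qs))
        q∣s : q ∣ s
        q∣s = ∣-trans q∣g (gcd[m,n]∣n j s)

  φ≡countTo-coprimeTo : φ s ≡ countTo (coprimeTo s) s
  φ≡countTo-coprimeTo = trans (length-filter (λ k → gcd k s ℕ.≟ 1) (map suc (upTo s)))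
    (trans (count-map (coprimeTo s) suc (upTo s)) (count-upTo (coprimeTo s) s))

  φ[s]≤s : φ s ≤ s
  φ[s]≤s = subst (_≤ s) (sym φ≡countTo-coprimeTo) (countTo≤ (coprimeTo s) s)

  countTo-coprimeTo-* : ∀ k → countTo (coprimeTo s) (k * s) ≡ k * φ s
  countTo-coprimeTo-* zero    = refl
  countTo-coprimeTo-* (suc k) = begin
      countTo (coprimeTo s) (s + k * s)
    ≡⟨ cong (countTo (coprimeTo s)) (+-comm s (k * s)) ⟩
      countTo (coprimeTo s) (k * s + s)
    ≡⟨ countTo-+ (coprimeTo s) (k * s) s ⟩
      countTo (coprimeTo s) (k * s) + countTo (λ j → coprimeTo s (k * s + j)) s
    ≡⟨ cong₂ _+_ (countTo-coprimeTo-* k) (countTo-cong (λ j → cong (λ g → does (g ℕ.≟ 1)) (gcd[k*s+j,s]≡gcd[j,s] k s j)) s) ⟩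
      k * φ s + countTo (coprimeTo s) s
    ≡⟨ cong (_+_ (k * φ s)) (sym φ≡countTo-coprimeTo) ⟩
      k * φ s + φ s
    ≡⟨ +-comm (k * φ s) (φ s) ⟩
      suc k * φ s ∎
    where open ≡-Reasoning

  product*φ≡s*productPred : product primeDivisors * φ s ≡ s * productPred primeDivisors
  product*φ≡s*productPred = begin
      product primeDivisors * φ s
    ≡⟨ countTo-coprimeTo-* (product primeDivisors) ⟨
      countTo (coprimeTo s) (product primeDivisors * s)
    ≡⟨ countTo-cong coprimeTo≡noneDivides (product primeDivisors * s) ⟩
      sifted primeDivisors (product primeDivisors * s)
    ≡⟨ sifted-product-multiple primeDivisors primeDivisors-distinct s ⟩
      s * productPred primeDivisors ∎
    where open ≡-Reasoning

  ∣s*countTo-coprimeTo-x*φ∣≤ : ∀ x → ∣ s * countTo (coprimeTo s) x - x * φ s ∣ ≤ s * 2 ^ suc (ω s)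
  ∣s*countTo-coprimeTo-x*φ∣≤ x = *-cancelˡ-≤ P (begin
      P * ∣ s * N - x * φ s ∣
    ≡⟨ *-distribˡ-∣-∣ P (s * N) (x * φ s) ⟩
      ∣ P * (s * N) - P * (x * φ s) ∣
    ≡⟨ cong₂ ∣_-_∣ (swap P s N) (trans (x*[y*z]≡y*[x*z] P x (φ s)) (cong (x *_) product*φ≡s*productPred)) ⟩
      ∣ s * (N * P) - x * (s * F) ∣
    ≡⟨ cong (∣_-_∣ (s * (N * P))) (x*[y*z]≡y*[x*z] x s F) ⟩
      ∣ s * (N * P) - s * (x * F) ∣
    ≡⟨ *-distribˡ-∣-∣ s (N * P) (x * F) ⟨
      s * ∣ N * P - x * F ∣
    ≡⟨ cong (λ n → s * ∣ n * P - x * F ∣) (countTo-cong coprimeTo≡noneDivides x) ⟩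
      s * ∣ sifted primeDivisors x * P - x * F ∣
    ≤⟨ *-monoʳ-≤ s (m+n≤o⇒m≤o _ (siftedError+product≤ primeDivisors primeDivisors-distinct x)) ⟩
      s * (P * 2 ^ suc (ω s))
    ≡⟨ x*[y*z]≡y*[x*z] s P (2 ^ suc (ω s)) ⟩
      P * (s * 2 ^ suc (ω s)) ∎)
    where
    open ≤-Reasoning
    P = product primeDivisors
    F = productPred primeDivisors
    N = countTo (coprimeTo s) x
    instance _ = productOfPrimes≢0 (proj₁ primeDivisors-distinct)
    swap : ∀ P s N → P * (s * N) ≡ s * (N * P)
    swap = solve-∀
    x*[y*z]≡y*[x*z] : ∀ x y z → x * (y * z) ≡ y * (x * z)
    x*[y*z]≡y*[x*z] = solve-∀

multipleOf : ℕ → ℕ → Bool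
multipleOf s j = does (s ∣? j)

coprimeMultipleOf : (s : ℕ) .{{_ : NonZero s}} → ℕ → Bool
coprimeMultipleOf s j = multipleOf s j ∧ coprimeTo s (j / s)

module _ (s : ℕ) .{{_ : NonZero s}} (H : ℕ) where

  private
    allMultiples : ∀ {n} → Vec ℤ n → Bool
    allMultiples v = does (VecAll.all? (λ c → s ∣? ∣ c ∣) v)

    lowerMultiples∧topCoprime : ∀ d → Vec ℤ (suc d) → Bool
    lowerMultiples∧topCoprime d a = allMultiples (Vec.init a) ∧ coprimeTo s ∣ Vec.last a ∣

    count-lowerMultiples∧topCoprime : ∀ d →
      count (lowerMultiples∧topCoprime d) (boxVecs (suc d) H) ≡ boxCount (multipleOf s) H ^ d * boxCount (coprimeTo s) H
    count-lowerMultiples∧topCoprime zero = begin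
        count (lowerMultiples∧topCoprime zero) (boxVecs 1 H)
      ≡⟨ count-concatMap-∷ _ (λ a → coprimeTo s ∣ a ∣) (λ _ → true) (λ { a Vec.[] → sym (∧-identityʳ _) })
                           (box H) (boxVecs 0 H) ⟩
        boxCount (coprimeTo s) H * 1
      ≡⟨ *-identityʳ _ ⟩
        boxCount (coprimeTo s) H
      ≡⟨ +-identityʳ _ ⟨
        1 * boxCount (coprimeTo s) H ∎
      where open ≡-Reasoning
    count-lowerMultiples∧topCoprime (suc d) = begin
        count (lowerMultiples∧topCoprime (suc d)) (boxVecs (suc (suc d)) H)
      ≡⟨ count-concatMap-∷ _ (λ a → multipleOf s ∣ a ∣) (lowerMultiples∧topCoprime d)
           (λ a r → ∧-assoc (multipleOf s ∣ a ∣) (allMultiples (Vec.init r)) (coprimeTo s ∣ Vec.last r ∣))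
           (box H) (boxVecs (suc d) H) ⟩
        boxCount (multipleOf s) H * count (lowerMultiples∧topCoprime d) (boxVecs (suc d) H)
      ≡⟨ cong (boxCount (multipleOf s) H *_) (count-lowerMultiples∧topCoprime d) ⟩
        boxCount (multipleOf s) H * (boxCount (multipleOf s) H ^ d * boxCount (coprimeTo s) H)
      ≡⟨ *-assoc (boxCount (multipleOf s) H) _ _ ⟨
        boxCount (multipleOf s) H ^ suc d * boxCount (coprimeTo s) H ∎
      where open ≡-Reasoning

  countH-factorisation : ∀ d → countH (suc d) s H ≡
    boxCount (coprimeMultipleOf s) H * (boxCount (multipleOf s) H ^ d * boxCount (coprimeTo s) H)
  countH-factorisation d = begin
      countH (suc d) s H
    ≡⟨ length-filter (InH? (suc d) s) (boxVecs (suc (suc d)) H) ⟩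
      count (λ a → does (InH? (suc d) s a)) (boxVecs (suc (suc d)) H)
    ≡⟨ count-concatMap-∷ _ (λ a → coprimeMultipleOf s ∣ a ∣) (lowerMultiples∧topCoprime d)
         (λ a r → ∧-interchange (multipleOf s ∣ a ∣) (allMultiples (Vec.init r))
                                (coprimeTo s (∣ a ∣ / s)) (coprimeTo s ∣ Vec.last r ∣))
         (box H) (boxVecs (suc d) H) ⟩
      boxCount (coprimeMultipleOf s) H * count (lowerMultiples∧topCoprime d) (boxVecs (suc d) H)
    ≡⟨ cong (boxCount (coprimeMultipleOf s) H *_) (count-lowerMultiples∧topCoprime d) ⟩
      boxCount (coprimeMultipleOf s) H * (boxCount (multipleOf s) H ^ d * boxCount (coprimeTo s) H) ∎
    where open ≡-Reasoning

scaledBoxCount≈ : ∀ g m c E H → ∣ m * countTo g H - H * c ∣ ≤ E → ∣ m * boxCount g H - 2 * H * c ∣ ≤ 2 * E + m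
scaledBoxCount≈ g m c E H approx = begin
    ∣ m * boxCount g H - 2 * H * c ∣
  ≡⟨ cong₂ ∣_-_∣ (trans (cong (m *_) (boxCount≡ g H)) (expand m (𝟙 (g 0)) (countTo g H))) (*-assoc 2 H c) ⟩
    ∣ 2 * (m * countTo g H) + m * 𝟙 (g 0) - 2 * (H * c) ∣
  ≤⟨ ∣m+o-n∣≤∣m-n∣+o (2 * (m * countTo g H)) (2 * (H * c)) (m * 𝟙 (g 0)) ⟩
    ∣ 2 * (m * countTo g H) - 2 * (H * c) ∣ + m * 𝟙 (g 0)
  ≡⟨ cong (_+ m * 𝟙 (g 0)) (*-distribˡ-∣-∣ 2 (m * countTo g H) (H * c)) ⟨
    2 * ∣ m * countTo g H - H * c ∣ + m * 𝟙 (g 0)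
  ≤⟨ +-mono-≤ (*-monoʳ-≤ 2 approx) (≤-trans (*-monoʳ-≤ m (𝟙≤1 (g 0))) (≤-reflexive (*-identityʳ m))) ⟩
    2 * E + m ∎
  where
  open ≤-Reasoning
  expand : ∀ m b N → m * (b + 2 * N) ≡ 2 * (m * N) + m * b
  expand = solve-∀

scaledBoxCount≤ : ∀ g m K H → m ≤ K → m * countTo g H ≤ K → m * boxCount g H ≤ 3 * K
scaledBoxCount≤ g m K H m≤K mN≤K = begin
    m * boxCount g H
  ≡⟨ cong (m *_) (boxCount≡ g H) ⟩
    m * (𝟙 (g 0) + 2 * countTo g H)
  ≡⟨ expand m (𝟙 (g 0)) (countTo g H) ⟩
    m * 𝟙 (g 0) + 2 * (m * countTo g H)
  ≤⟨ +-mono-≤ (≤-trans (*-monoʳ-≤ m (𝟙≤1 (g 0))) (≤-trans (≤-reflexive (*-identityʳ m)) m≤K)) (*-monoʳ-≤ 2 mN≤K) ⟩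
    3 * K ∎
  where
  open ≤-Reasoning
  expand : ∀ m b N → m * (b + 2 * N) ≡ m * b + 2 * (m * N)
  expand = solve-∀

module _ (s : ℕ) .{{_ : NonZero s}} where

  countTo-multipleOf : ∀ x → countTo (multipleOf s) x ≡ x / s
  countTo-multipleOf x = begin
      countTo (multipleOf s) x
    ≡⟨ countTo-cong (λ j → sym (∧-identityʳ (multipleOf s j))) x ⟩
      countTo (λ j → multipleOf s j ∧ true) x
    ≡⟨ countTo-multiples s (λ _ → true) (λ _ → true) (λ _ → refl) x ⟩
      countTo (λ _ → true) (x / s)
    ≡⟨ countTo-true (x / s) ⟩
      x / s ∎
    where open ≡-Reasoning

  countTo-coprimeMultipleOf : ∀ x → countTo (coprimeMultipleOf s) x ≡ countTo (coprimeTo s) (x / s)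
  countTo-coprimeMultipleOf =
    countTo-multiples s (λ j → coprimeTo s (j / s)) (coprimeTo s) (λ c → cong (coprimeTo s) (m*n/n≡m c s))

  ∣s*countTo-multipleOf-x∣≤ : ∀ x → ∣ s * countTo (multipleOf s) x - x * 1 ∣ ≤ s
  ∣s*countTo-multipleOf-x∣≤ x = begin
      ∣ s * countTo (multipleOf s) x - x * 1 ∣
    ≡⟨ cong₂ ∣_-_∣ (cong (s *_) (countTo-multipleOf x)) x*1≡s*[x/s]+x%s ⟩
      ∣ s * (x / s) - (s * (x / s) + x % s) ∣
    ≡⟨ ∣m-m+n∣≡n (s * (x / s)) (x % s) ⟩
      x % s
    ≤⟨ <⇒≤ (m%n<n x s) ⟩
      s ∎
    where
    open ≤-Reasoning
    x*1≡s*[x/s]+x%s : x * 1 ≡ s * (x / s) + x % s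
    x*1≡s*[x/s]+x%s = trans (*-identityʳ x) (trans (m≡m%n+[m/n]*n x s) (trans (+-comm (x % s) _) (cong (_+ x % s) (*-comm (x / s) s))))

  ∣s*s*countTo-coprimeMultipleOf-x*φ∣≤ : ∀ x →
    ∣ s * s * countTo (coprimeMultipleOf s) x - x * φ s ∣ ≤ s * (s * 2 ^ suc (ω s)) + s * s
  ∣s*s*countTo-coprimeMultipleOf-x*φ∣≤ x = begin
      ∣ s * s * countTo (coprimeMultipleOf s) x - x * φ s ∣
    ≡⟨ cong₂ ∣_-_∣ (trans (*-assoc s s _) (cong (λ n → s * (s * n)) (countTo-coprimeMultipleOf x))) x*φ≡ ⟩
      ∣ s * (s * N) - (s * (q * φ s) + r * φ s) ∣
    ≤⟨ ∣m-n+o∣≤∣m-n∣+o (s * (s * N)) (s * (q * φ s)) (r * φ s) ⟩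
      ∣ s * (s * N) - s * (q * φ s) ∣ + r * φ s
    ≡⟨ cong (_+ r * φ s) (*-distribˡ-∣-∣ s (s * N) (q * φ s)) ⟨
      s * ∣ s * N - q * φ s ∣ + r * φ s
    ≤⟨ +-mono-≤ (*-monoʳ-≤ s (∣s*countTo-coprimeTo-x*φ∣≤ s q)) (*-mono-≤ (<⇒≤ (m%n<n x s)) (φ[s]≤s s)) ⟩
      s * (s * 2 ^ suc (ω s)) + s * s ∎
    where
    open ≤-Reasoning
    q = x / s
    r = x % s
    N = countTo (coprimeTo s) q
    x*φ≡ : x * φ s ≡ s * (q * φ s) + r * φ s
    x*φ≡ = trans (cong (_* φ s) (trans (m≡m%n+[m/n]*n x s) (+-comm r (q * s)))) (distribute q s r (φ s))
      where
      distribute : ∀ q s r f → (q * s + r) * f ≡ s * (q * f) + r * f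
      distribute = solve-∀

errorConstant : ℕ → ℕ
errorConstant e = (135 + 27 * e) * 3 ^ e

module _ (s H : ℕ) .{{_ : NonZero s}} (s≤H : s ≤ H) where

  private
    w = 2 ^ ω s
    instance _ = m^n≢0 2 (ω s)

    a b c t u v : ℕ
    a = s * s * boxCount (coprimeMultipleOf s) H
    b = s * boxCount (multipleOf s) H
    c = s * boxCount (coprimeTo s) H
    t = 2 * H * φ s
    u = 2 * H
    v = 2 * H * φ s

    a≈t : ∣ a - t ∣ ≤ 7 * (s * (s * w))
    a≈t = begin
        ∣ a - t ∣
      ≤⟨ scaledBoxCount≈ (coprimeMultipleOf s) (s * s) (φ s) _ H (∣s*s*countTo-coprimeMultipleOf-x*φ∣≤ s H) ⟩
        2 * (s * (s * (2 * w)) + s * s) + s * s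
      ≡⟨ collect s w ⟩
        4 * (s * (s * w)) + 3 * (s * s)
      ≤⟨ +-monoʳ-≤ (4 * (s * (s * w))) (*-monoʳ-≤ 3 (*-monoʳ-≤ s (m≤m*n s w))) ⟩
        4 * (s * (s * w)) + 3 * (s * (s * w))
      ≡⟨ *-distribʳ-+ (s * (s * w)) 4 3 ⟨
        7 * (s * (s * w)) ∎
      where
      open ≤-Reasoning
      collect : ∀ s w → 2 * (s * (s * (2 * w)) + s * s) + s * s ≡ 4 * (s * (s * w)) + 3 * (s * s)
      collect = solve-∀

    b≈u : ∣ b - u ∣ ≤ 3 * (s * w)
    b≈u = begin
        ∣ b - u ∣
      ≡⟨ cong (∣_-_∣ b) (*-identityʳ u) ⟨
        ∣ b - u * 1 ∣
      ≤⟨ scaledBoxCount≈ (multipleOf s) s 1 s H (∣s*countTo-multipleOf-x∣≤ s H) ⟩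
        2 * s + s
      ≡⟨ +-comm (2 * s) s ⟩
        3 * s
      ≤⟨ *-monoʳ-≤ 3 (m≤m*n s w) ⟩
        3 * (s * w) ∎
      where open ≤-Reasoning

    c≈v : ∣ c - v ∣ ≤ 5 * (s * (s * w))
    c≈v = begin
        ∣ c - v ∣
      ≤⟨ scaledBoxCount≈ (coprimeTo s) s (φ s) _ H (∣s*countTo-coprimeTo-x*φ∣≤ s H) ⟩
        2 * (s * (2 * w)) + s
      ≡⟨ collect s w ⟩
        4 * (s * w) + s
      ≤⟨ +-mono-≤ (*-monoʳ-≤ 4 sw≤ssw) (≤-trans (m≤m*n s w) sw≤ssw) ⟩
        4 * (s * (s * w)) + s * (s * w)
      ≡⟨ +-comm (4 * (s * (s * w))) (s * (s * w)) ⟩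
        5 * (s * (s * w)) ∎
      where
      open ≤-Reasoning
      sw≤ssw : s * w ≤ s * (s * w)
      sw≤ssw = m≤n*m (s * w) s
      collect : ∀ s w → 2 * (s * (2 * w)) + s ≡ 4 * (s * w) + s
      collect = solve-∀

    b≤ : b ≤ 3 * H
    b≤ = scaledBoxCount≤ (multipleOf s) s H H s≤H
      (subst (_≤ H) (trans (*-comm (H / s) s) (cong (s *_) (sym (countTo-multipleOf s H)))) (m/n*n≤m H s))

    u≤ : u ≤ 3 * H
    u≤ = *-monoˡ-≤ H (n≤1+n 2)

    c≤ : c ≤ 3 * (H * s)
    c≤ = scaledBoxCount≤ (coprimeTo s) s (H * s) H (≤-trans s≤H (m≤m*n H s))
      (≤-trans (*-monoʳ-≤ s (countTo≤ (coprimeTo s) H)) (≤-reflexive (*-comm s H)))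

    t≤ : t ≤ 3 * (H * s)
    t≤ = ≤-trans (*-mono-≤ u≤ (φ[s]≤s s)) (≤-reflexive (*-assoc 3 H s))

    countH-scaled : ∀ e → countH (2 + e) s H * s ^ (2 + e + 2) ≡ a * (b ^ suc e * c)
    countH-scaled e = begin
        countH (2 + e) s H * s ^ (2 + e + 2)
      ≡⟨ cong₂ _*_ (countH-factorisation s H (suc e)) (cong (λ n → s * (s * n)) (^-distribˡ-+-* s e 2)) ⟩
        N₀ * ((Nₘ * Nₘ ^ e) * N_d) * (s * (s * (s ^ e * (s * (s * 1)))))
      ≡⟨ regroup N₀ Nₘ (Nₘ ^ e) N_d s (s ^ e) ⟩
        a * ((s * Nₘ * (s ^ e * Nₘ ^ e)) * c)
      ≡⟨ cong (λ n → a * ((s * Nₘ * n) * c)) (^-distrib-* s Nₘ e) ⟨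
        a * (b ^ suc e * c) ∎
      where
      open ≡-Reasoning
      N₀ = boxCount (coprimeMultipleOf s) H
      Nₘ = boxCount (multipleOf s) H
      N_d = boxCount (coprimeTo s) H
      regroup : ∀ A M Mᵉ C s sᵉ →
        A * ((M * Mᵉ) * C) * (s * (s * (sᵉ * (s * (s * 1))))) ≡ s * s * A * ((s * M * (sᵉ * Mᵉ)) * (s * C))
      regroup = solve-∀

    target-scaled : ∀ e → 2 ^ (2 + e + 1) * H ^ (2 + e + 1) * φ s * φ s ≡ t * (u ^ suc e * v)
    target-scaled e = begin
        2 ^ (2 + e + 1) * H ^ (2 + e + 1) * φ s * φ s
      ≡⟨ cong₂ (λ m n → 2 * (2 * m) * (H * (H * n)) * φ s * φ s) (^-distribˡ-+-* 2 e 1) (^-distribˡ-+-* H e 1) ⟩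
        2 * (2 * (2 ^ e * (2 * 1))) * (H * (H * (H ^ e * (H * 1)))) * φ s * φ s
      ≡⟨ regroup (2 ^ e) (H ^ e) H (φ s) ⟩
        t * ((u * (2 ^ e * H ^ e)) * v)
      ≡⟨ cong (λ n → t * ((u * n) * v)) (^-distrib-* 2 H e) ⟨
        t * (u ^ suc e * v) ∎
      where
      open ≡-Reasoning
      regroup : ∀ 2ᵉ Hᵉ H f →
        2 * (2 * (2ᵉ * (2 * 1))) * (H * (H * (Hᵉ * (H * 1)))) * f * f ≡ 2 * H * f * ((2 * H * (2ᵉ * Hᵉ)) * (2 * H * f))
      regroup = solve-∀

  countH-error : ∀ e →
    ∣ countH (2 + e) s H * s ^ (2 + e + 2) - 2 ^ (2 + e + 1) * H ^ (2 + e + 1) * φ s * φ s ∣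
      ≤ errorConstant e * H ^ (2 + e) * s ^ 3 * 2 ^ ω s
  countH-error e = begin
      ∣ countH (2 + e) s H * s ^ (2 + e + 2) - 2 ^ (2 + e + 1) * H ^ (2 + e + 1) * φ s * φ s ∣
    ≡⟨ cong₂ ∣_-_∣ (countH-scaled e) (target-scaled e) ⟩
      ∣ a * (b ^ suc e * c) - t * (u ^ suc e * v) ∣
    ≤⟨ ∣a*b^n*c-t*u^n*v∣≤ {a} {b} {c} {t} {u} {v} e a≈t b≈u c≈v t≤ b≤ u≤ c≤ ⟩
      7 * (s * (s * w)) * ((3 * H) ^ suc e * (3 * (H * s)))
        + 3 * (H * s) * (suc e * (3 * (s * w)) * (3 * H) ^ e * (3 * (H * s)) + (3 * H) ^ suc e * (5 * (s * (s * w))))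
    ≡⟨ cong (λ n → 7 * (s * (s * w)) * (3 * H * n * (3 * (H * s)))
                   + 3 * (H * s) * (suc e * (3 * (s * w)) * n * (3 * (H * s)) + 3 * H * n * (5 * (s * (s * w)))))
            (^-distrib-* 3 H e) ⟩
      7 * (s * (s * w)) * (3 * H * (3 ^ e * H ^ e) * (3 * (H * s)))
        + 3 * (H * s) * (suc e * (3 * (s * w)) * (3 ^ e * H ^ e) * (3 * (H * s)) + 3 * H * (3 ^ e * H ^ e) * (5 * (s * (s * w))))
    ≡⟨ collect e (3 ^ e) (H ^ e) H s w ⟩
      errorConstant e * H ^ (2 + e) * s ^ 3 * w ∎
    where
    open ≤-Reasoning
    collect : ∀ e 3ᵉ Hᵉ H s w →
      7 * (s * (s * w)) * (3 * H * (3ᵉ * Hᵉ) * (3 * (H * s)))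
        + 3 * (H * s) * (suc e * (3 * (s * w)) * (3ᵉ * Hᵉ) * (3 * (H * s)) + 3 * H * (3ᵉ * Hᵉ) * (5 * (s * (s * w))))
      ≡ (135 + 27 * e) * 3ᵉ * (H * (H * Hᵉ)) * (s * (s * (s * 1))) * w
    collect = solve-∀

lemma3 : (d : ℕ) → 2 ≤ d →
    ∃ λ (C : ℕ) → (s H : ℕ) .{{_ : NonZero s}} → 1 ≤ H → s ≤ H →
    ∣ (+ (countH d s H * s ^ (d + 2))) ℤ.- (+ (2 ^ (d + 1) * H ^ (d + 1) * φ s * φ s)) ∣
    ≤ C * H ^ d * s ^ 3 * 2 ^ ω s
lemma3 (suc zero) (s≤s ())
lemma3 (suc (suc e)) _ = errorConstant e , λ s H _ s≤H →
  ≤-trans (≤-reflexive (∣+m-+n∣≡∣m-n∣ (countH (2 + e) s H * s ^ (2 + e + 2)) (2 ^ (2 + e + 1) * H ^ (2 + e + 1) * φ s * φ s)))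
          (countH-error s H s≤H e)
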